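{- If $K$ is a pseudo-universal AEC, then $K$ is fully $(<\aleph_0)$-tame and short.
   Context: AEC. An abstract elementary class (AEC) is a pair $(K,\le)$ where $K$ is a class of structures in a fixed language $L(K)$, $\le$ is a partial order on $K$, both are closed under isomorphism, $M\le N$ implies $M\subseteq N$, and: (coherence) $M_0\le M_2$, $M_1\le M_2$, $M_0\subseteq M_1$ imply $M_0\le M_1$; (Tarski-Vaught) the union $M_\delta$ of a $\le$-increasing chain $\langle M_i:i<\delta\rangle$ ($\delta$ limit) is in $K$, $M_0\le M_\delta$, and if $M_i\le N$ for all $i$ then $M_\delta\le N$; (Löwenheim-Skolem-Tarski) there is a cardinal $\lambda\ge |L(K)|+\aleph_0$ such that for all $M\in K$ and $A\subseteq|M|$ there is $M_0\le M$ with $A\subseteq |M_0|$ and $\|M_0\|\le |A|+\lambda$; $\mathrm{LS}(K)$ is the least such $\lambda$. Here $|M|$ is the universe and $\|M\|$ the cardinality of $M$. A $K$-embedding $f:M\to N$ is an isomorphism of $M$ onto some $f[M]\le N$. Galois types. For $N\in K$, $A\subseteq|N|$, $\bar b$ a (possibly infinite) sequence from $N$, consider triples $(\bar b,A,N)$. Put $(\bar b_1,A,N_1)E_{\mathrm{at}}(\bar b_2,A,N_2)$ if there are $N\in K$ and $K$-embeddings $f_\ell:N_\ell\to N$ fixing $A$ pointwise with $f_1(\bar b_1)=f_2(\bar b_2)$; $E$ is the transitive closure of $E_{\mathrm{at}}$, and $\mathrm{gtp}(\bar b/A;N)$ is the $E$-class of $(\bar b,A,N)$. $\mathrm{gS}^\alpha(M)$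 is the set of all $\mathrm{gtp}(\bar b/M;N)$ with $M\le N$ and $\bar b$ of length $\alpha$. For $p=\mathrm{gtp}(\bar b/M;N)\in\mathrm{gS}^\alpha(M)$, $I\subseteq\alpha$, $A\subseteq|M|$, $p^I\restriction A:=\mathrm{gtp}(\bar b\restriction I/A;N)$. $K$ is fully $(<\kappa)$-tame and short if for any $M\in K$, ordinal $\alpha$, and $p\ne q$ in $\mathrm{gS}^\alpha(M)$ there are $I\subseteq\alpha$, $A\subseteq|M|$ with $|I|+|A|<\kappa$ and $p^I\restriction A\ne q^I\restriction A$. Pseudo-universal. For $N\in K$ and $A\subseteq|N|$, $\mathrm{cl}^N(A):=\bigcap\{|M|: M\le N, A\subseteq|M|\}$. $K$ admits intersections if for all $N\in K$ and $A\subseteq |N|$, $\mathrm{cl}^N(A)$ is the universe of some $M_0\le N$ (with which it is identified). $K$ is pseudo-universal if it admits intersections and for any $N_1,N_2,\bar a_1,\bar a_2$, if $\mathrm{gtp}(\bar a_1/\emptyset;N_1)=\mathrm{gtp}(\bar a_2/\emptyset;N_2)$ and $f,g:\mathrm{cl}^{N_1}(\bar a_1)\cong\mathrm{cl}^{N_2}(\bar a_2)$ satisfy $f(\bar a_1)=g(\bar a_1)=\bar a_2$, then $f=g$. (Every universal class, i.e. a class of structures in a fixed language closed under isomorphism, substructures and unions of $\subseteq$-increasing chains, is pseudo-universal when ordered by $\subseteq$.) -}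

module Defs where

open import Level using (Level; _⊔_) renaming (suc to lsuc)
open import Data.Empty.Polymorphic using (⊥)
open import Data.Nat.Base using (ℕ)
open import Data.Product using (Σ; Σ-syntax; ∃; ∃-syntax; _×_; _,_; proj₁; proj₂)
open import Data.Product.Properties using (Σ-≡,≡→≡)
open import Data.Sum.Base using (_⊎_)
open import Data.Vec.Base using (Vec; map)
open import Data.Vec.Properties using (map-∘; map-id)
open import Function.Base using (id; _∘_)
open import Function.Bundles using (_⇔_; mk⇔; _↣_; mk↣; module Equivalence; module Injection)
open import Function.Definitions using (Injective; Surjective)
open import Induction.WellFounded using (WellFounded)
open import Relation.Binary.Core using (Rel)
open import Relation.Binary.Structures using (IsStrictTotalOrder)
open import Relation.Binary.Construct.Closure.Transitive using (TransClosure)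
open import Relation.Binary.PropositionalEquality
  using (_≡_; refl; sym; trans; cong; subst)
open import Relation.Nullary using (¬_)
open import Relation.Unary using (Pred; Irrelevant; _∈_; _⊆_)

-- Sets are types in Set ℓ, with _≡_ as equality; classes of structures
-- live one universe higher.

-- A subset whose cardinality matters is a proof-irrelevant predicate, so
-- that the type El P below has exactly one element per member.

record Subset {ℓ} (X : Set ℓ) : Set (lsuc ℓ) where
  field
    member     : Pred X ℓ
    irrelevant : Irrelevant member

  El : Set ℓ
  El = Σ X member

  El↣ : El ↣ X
  El↣ = mk↣ {to = proj₁} λ eq → Σ-≡,≡→≡ (eq , irrelevant _ _)

open Subset public using (member; El; El↣)

range : ∀ {a b} {A : Set a} {B : Set b} → (A → B) → Pred B (a ⊔ b)
range f y = ∃[ x ] f x ≡ y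

-- A cardinal is represented by any type of that cardinality.

_<ᶜ_ : ∀ {a b} → Set a → Set b → Set (a ⊔ b)
X <ᶜ κ = (X ↣ κ) × ¬ (κ ↣ X)

ℵ₀ : Set
ℵ₀ = ℕ

record Ordinal ℓ : Set (lsuc ℓ) where
  field
    Index              : Set ℓ
    _<_                : Rel Index ℓ
    isStrictTotalOrder : IsStrictTotalOrder _≡_ _<_
    wellFounded        : WellFounded _<_

  IsLeast : Pred Index ℓ
  IsLeast i = ∀ j → ¬ (j < i)

  IsLimit : Set ℓ
  IsLimit = Index × (∀ i → ∃[ j ] i < j)

open Ordinal public using (Index)

record Language ℓ : Set (lsuc ℓ) where
  field
    Fun Rl   : Set ℓ
    funArity : Fun → ℕ
    relArity : Rl → ℕ

record Structure {ℓ} (L : Language ℓ) : Set (lsuc ℓ) where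
  open Language L
  field
    Universe : Set ℓ
    fun      : (F : Fun) → Vec Universe (funArity F) → Universe
    rel      : (R : Rl) → Pred (Vec Universe (relArity R)) ℓ

∣_∣ : ∀ {ℓ} {L : Language ℓ} → Structure L → Set ℓ
∣ M ∣ = Structure.Universe M

module _ {ℓ} {L : Language ℓ} where
  open Language L
  open Structure

  -- Distinct types share no elements, so "M is a substructure of N" is
  -- the datum of an inclusion map, that is, of an embedding M ↪ N.

  record _↪_ (M N : Structure L) : Set ℓ where
    field
      to        : ∣ M ∣ → ∣ N ∣
      injective : Injective _≡_ _≡_ to
      fun-homo  : ∀ F xs → to (fun M F xs) ≡ fun N F (map to xs)
      rel-homo  : ∀ R xs → rel M R xs ⇔ rel N R (map to xs)

  open _↪_ public using (to)

  record _≅_ (M N : Structure L) : Set ℓ where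
    field
      embedding  : M ↪ N
      surjective : Surjective _≡_ _≡_ (to embedding)

  open _≅_ public using (embedding)

  ↪-id : ∀ {M} → M ↪ M
  ↪-id {M} = record
    { to        = id
    ; injective = id
    ; fun-homo  = λ F xs → cong (fun M F) (sym (map-id xs))
    ; rel-homo  = λ R xs → mk⇔ (subst (rel M R) (sym (map-id xs)))
                               (subst (rel M R) (map-id xs))
    }

  infixr 9 _∘↪_

  _∘↪_ : ∀ {M N P} → N ↪ P → M ↪ N → M ↪ P
  _∘↪_ {M} {N} {P} g f = record
    { to        = to g ∘ to f
    ; injective = f.injective ∘ g.injective
    ; fun-homo  = λ F xs →
        trans (cong (to g) (f.fun-homo F xs))
       (trans (g.fun-homo F (map (to f) xs))
              (cong (fun P F) (sym (map-∘ (to g) (to f) xs))))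
    ; rel-homo  = λ R xs → mk⇔
        (λ r → subst (rel P R) (sym (map-∘ (to g) (to f) xs))
                 (Equivalence.to (g.rel-homo R _)
                   (Equivalence.to (f.rel-homo R xs) r)))
        (λ r → Equivalence.from (f.rel-homo R xs)
                 (Equivalence.from (g.rel-homo R _)
                   (subst (rel P R) (map-∘ (to g) (to f) xs) r)))
    }
    where
    module f = _↪_ f
    module g = _↪_ g

  -- Because the length is a limit and inclusions are injective, inc-trans
  -- also makes inc p independent of the proof p.

  record Chain : Set (lsuc ℓ) where
    field
      length    : Ordinal ℓ
      isLimit   : Ordinal.IsLimit length
    open Ordinal length public using (_<_; IsLeast)
    field
      stage     : Index length → Structure L
      inc       : ∀ {i j} → i < j → stage i ↪ stage j
      inc-trans : ∀ {i j k} (p : i < j) (q : j < k) (r : i < k) x →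
                  to (inc q) (to (inc p) x) ≡ to (inc r) x

  record IsUnion (C : Chain) (Mδ : Structure L) : Set ℓ where
    open Chain C
    field
      ι       : ∀ i → stage i ↪ Mδ
      ι-inc   : ∀ {i j} (p : i < j) x → to (ι j) (to (inc p) x) ≡ to (ι i) x
      covers  : ∀ y → ∃[ i ] y ∈ range (to (ι i))

-- M ≤ N via i: the inclusion i exhibits M as a substructure of N, and
-- with this identification M ≤ N.  As ≤ is closed under isomorphism,
-- the maps i with M ≤ N via i are precisely the K-embeddings.
-- Antisymmetry needs no field: if M ≤ N and N ≤ M, then M and N have the
-- same universe and the inclusions are mutually inverse.

record AEC (ℓ k : Level) : Set (lsuc (ℓ ⊔ k)) where
  field
    L        : Language ℓ
    K        : Pred (Structure L) k
    _≤_via_  : (M N : Structure L) → M ↪ N → Set k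

    ≤-in-K   : ∀ {M N i} → M ≤ N via i → K M × K N
    ≤-refl   : ∀ {M} → K M → M ≤ M via ↪-id
    ≤-trans  : ∀ {M N P} {i : M ↪ N} {j : N ↪ P} →
               M ≤ N via i → N ≤ P via j → M ≤ P via (j ∘↪ i)

    K-resp-≅ : ∀ {M N} → M ≅ N → K M → K N
    ≤-resp-≅ : ∀ {M N M′ N′} {i : M ↪ N} {i′ : M′ ↪ N′}
               (f : M ≅ M′) (g : N ≅ N′) →
               (∀ x → to (embedding g) (to i x) ≡ to i′ (to (embedding f) x)) →
               M ≤ N via i → M′ ≤ N′ via i′

    coherence : ∀ {M₀ M₁ M₂} {i : M₀ ↪ M₂} {j : M₁ ↪ M₂} (h : M₀ ↪ M₁) →
                (∀ x → to j (to h x) ≡ to i x) →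
                M₀ ≤ M₂ via i → M₁ ≤ M₂ via j → M₀ ≤ M₁ via h

    -- In the last clause h is the inclusion Mδ ⊆ N that inclusions of
    -- all the stages into N determine, and h ∘↪ ι i is the inclusion of
    -- stage i.
    tarski-vaught :
      ∀ (C : Chain) {Mδ} (u : IsUnion C Mδ) →
      let open Chain C; open IsUnion u in
      (∀ {i j} (p : i < j) → stage i ≤ stage j via inc p) →
        K Mδ
      × (∀ i → IsLeast i → stage i ≤ Mδ via ι i)
      × (∀ {N} (h : Mδ ↪ N) → (∀ i → stage i ≤ N via (h ∘↪ ι i)) →
           Mδ ≤ N via h)

    löwenheim-skolem-tarski :
      Σ[ Λ ∈ Set ℓ ]
        (((Language.Fun L ⊎ Language.Rl L) ⊎ ℵ₀) ↣ Λ)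
      × (∀ {M} → K M → (A : Subset ∣ M ∣) →
           Σ[ M₀ ∈ Structure L ] Σ[ i ∈ M₀ ↪ M ]
             M₀ ≤ M via i × member A ⊆ range (to i) × (∣ M₀ ∣ ↣ (El A ⊎ Λ)))

module _ {ℓ k} (𝐊 : AEC ℓ k) where
  open AEC 𝐊

  -- A triple (b̄ , A , N), where b̄ is indexed by X and the set A, regarded
  -- as a subset of |N| through an injection, is allowed to sit in
  -- several structures at once.

  record Triple (X A : Set ℓ) : Set (lsuc ℓ ⊔ k) where
    field
      N    : Structure L
      N∈K  : K N
      base : A ↣ ∣ N ∣
      seq  : X → ∣ N ∣

  E-at : ∀ {X A} → Rel (Triple X A) (lsuc ℓ ⊔ k)
  E-at t₁ t₂ =
    Σ[ N ∈ Structure L ] Σ[ f₁ ∈ T₁.N ↪ N ] Σ[ f₂ ∈ T₂.N ↪ N ]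
      T₁.N ≤ N via f₁ × T₂.N ≤ N via f₂
    × (∀ a → to f₁ (Injection.to T₁.base a) ≡ to f₂ (Injection.to T₂.base a))
    × (∀ x → to f₁ (T₁.seq x) ≡ to f₂ (T₂.seq x))
    where
    module T₁ = Triple t₁
    module T₂ = Triple t₂

  -- gtp(b̄₁/A;N₁) = gtp(b̄₂/A;N₂); types are handled through representing
  -- triples, with this relation as their equality.

  _≡gtp_ : ∀ {X A} → Rel (Triple X A) (lsuc ℓ ⊔ k)
  _≡gtp_ = TransClosure E-at

  gtp∅ : ∀ {X} (N : Structure L) → K N → (X → ∣ N ∣) → Triple X ⊥
  gtp∅ N N∈K b = record
    { N = N ; N∈K = N∈K ; base = mk↣ {to = λ ()} (λ { {()} }) ; seq = b }

  -- Representatives of the elements of gS^α(M).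

  record gS (α : Ordinal ℓ) (M : Structure L) : Set (lsuc ℓ ⊔ k) where
    field
      N   : Structure L
      inc : M ↪ N
      M≤N : M ≤ N via inc
      seq : Index α → ∣ N ∣

  gtp : ∀ {α M} → gS α M → Triple (Index α) ∣ M ∣
  gtp p = record
    { N    = N
    ; N∈K  = proj₂ (≤-in-K M≤N)
    ; base = mk↣ {to = to inc} (_↪_.injective inc)
    ; seq  = seq
    }
    where open gS p

  restrict : ∀ {α M} → gS α M → (I : Subset (Index α)) (A : Subset ∣ M ∣) →
             Triple (El I) (El A)
  restrict p I A = record
    { N    = N
    ; N∈K  = proj₂ (≤-in-K M≤N)
    ; base = mk↣ {to = to inc ∘ proj₁}
               (Injection.injective (El↣ A) ∘ _↪_.injective inc)
    ; seq  = seq ∘ proj₁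
    }
    where open gS p

  FullyTameAndShort : ∀ {c} (κ : Set c) → Set (lsuc ℓ ⊔ k ⊔ c)
  FullyTameAndShort κ =
    ∀ {M} → K M → (α : Ordinal ℓ) (p q : gS α M) → ¬ (gtp p ≡gtp gtp q) →
    Σ[ I ∈ Subset (Index α) ] Σ[ A ∈ Subset ∣ M ∣ ]
      (El I ⊎ El A) <ᶜ κ × ¬ (restrict p I A ≡gtp restrict q I A)

  cl : (N : Structure L) → Pred ∣ N ∣ ℓ → Pred ∣ N ∣ (lsuc ℓ ⊔ k)
  cl N A x = ∀ {M} (i : M ↪ N) → M ≤ N via i →
             A ⊆ range (to i) → x ∈ range (to i)

  record Closure (N : Structure L) (A : Pred ∣ N ∣ ℓ) : Set (lsuc ℓ ⊔ k) where
    field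
      M₀       : Structure L
      inc      : M₀ ↪ N
      M₀≤N     : M₀ ≤ N via inc
      universe : ∀ x → x ∈ range (to inc) ⇔ x ∈ cl N A

  AdmitsIntersections : Set (lsuc ℓ ⊔ k)
  AdmitsIntersections = ∀ {N} → K N → (A : Pred ∣ N ∣ ℓ) → Closure N A

  -- h(ā₁) = ā₂, for ā₁ in M₁ ≤ N₁ and ā₂ in M₂ ≤ N₂ given in N₁ and N₂.

  Sends : ∀ {X : Set ℓ} {N₁ N₂ : Structure L}
          {a₁ : X → ∣ N₁ ∣} {a₂ : X → ∣ N₂ ∣}
          (C₁ : Closure N₁ (range a₁)) (C₂ : Closure N₂ (range a₂)) →
          Closure.M₀ C₁ ≅ Closure.M₀ C₂ → Set ℓ
  Sends {a₁ = a₁} {a₂} C₁ C₂ h =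
    ∀ x c → to (Closure.inc C₁) c ≡ a₁ x →
    to (Closure.inc C₂) (to (embedding h) c) ≡ a₂ x

  PseudoUniversal : Set (lsuc ℓ ⊔ k)
  PseudoUniversal =
      AdmitsIntersections
    × (∀ {N₁ N₂} (N₁∈K : K N₁) (N₂∈K : K N₂) (α : Ordinal ℓ)
         (a₁ : Index α → ∣ N₁ ∣) (a₂ : Index α → ∣ N₂ ∣) →
       gtp∅ N₁ N₁∈K a₁ ≡gtp gtp∅ N₂ N₂∈K a₂ →
       (C₁ : Closure N₁ (range a₁)) (C₂ : Closure N₂ (range a₂))
       (f g : Closure.M₀ C₁ ≅ Closure.M₀ C₂) →
       Sends C₁ C₂ f → Sends C₁ C₂ g →
       ∀ c → to (embedding f) c ≡ to (embedding g) c)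

{-# OPTIONS --safe #-}

-- Two sequences have the same Galois type exactly when some member of K
-- embeds into both ambient structures and contains a common preimage of
-- the sequences; closures serve as pullbacks in the proof of
-- transitivity.  In a pseudo-universal class the resulting K-embedding
-- cl(ā₁) → N₂ is determined by the image of ā₁, so the embeddings of the
-- closures of a chain of subsequences cohere, and by Tarski-Vaught their
-- union is again a K-embedding.  Well-order M ⊎ α and show by induction
-- on initial segments D that, for every finite set G, the restrictions
-- to D ∪ G have the same type.  If D is of limit type this is the chain
-- argument; a greatest element of D is moved into G instead.

module Submission where

open import Defs
open import Axiom.ExcludedMiddle using (ExcludedMiddle)
open import Axiom.Extensionality.Propositional using (Extensionality)
open import Data.Bool.Base using (Bool; true; T; _∨_)
open import Data.Bool.Properties using (T-∨; T-≡; ⇔→≡)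
open import Data.Empty using (⊥-elim)
open import Data.Fin.Base using (Fin; toℕ)
open import Data.Fin.Properties using (toℕ-injective; ℕ→Fin-notInjective)
import Data.List.Base as List
open import Data.List.Base using (List; []; _∷_)
open import Data.List.Membership.Propositional renaming (_∈_ to _∈ˡ_)
open import Data.List.Membership.Setoid.Properties using (index-injective)
open import Data.List.Relation.Unary.Any using (here; there; index)
open import Data.Maybe.Base using (Maybe; just; nothing)
open import Data.Maybe.Properties using (just-injective)
open import Data.Product using (Σ; Σ-syntax; ∃-syntax; _×_; _,_; proj₁; proj₂)
open import Data.Sum.Base using (_⊎_; inj₁; inj₂; [_,_]′)
open import Data.Sum.Properties using (inj₁-injective; inj₂-injective)
open import Data.Unit.Base using (⊤; tt)
open import Data.Vec.Base using (Vec; []; _∷_; map)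
open import Data.Vec.Properties using (map-∘; map-cong)
open import Function.Base using (id; _∘_; case_of_)
open import Function.Bundles
  using (_⇔_; mk⇔; mk↣; module Equivalence; module Injection)
open import Induction.WellFounded using (Acc; acc)
open import Level using (Level; _⊔_; Lift; lift; lower) renaming (suc to lsuc)
open import Relation.Binary.Construct.Closure.Transitive using ([_]; _∷_)
import Relation.Binary.Construct.On as On
open import Relation.Binary.Core using (Rel)
open import Relation.Binary.Definitions
  using (tri<; tri≈; tri>; Trichotomous; Transitive)
open import Relation.Binary.PropositionalEquality
  using (_≡_; refl; sym; trans; cong; cong₂; subst; setoid; isEquivalence;
         resp₂; module ≡-Reasoning)
open import Relation.Binary.Structures using (IsStrictTotalOrder)
open import Relation.Nullary using (¬_; yes; no)
open import Relation.Nullary.Decidable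
  using (⌊_⌋; toWitness; fromWitness; decidable-stable)
open import Relation.Unary using (Pred; _∈_; _⊆_)

-- Zermelo's theorem.  Excluded middle holds for all types, not only for
-- propositions, so it also acts as a choice operator; subsets are
-- Bool-valued to keep families of subsets in Set ℓ.

module WellOrdering
  (em : ∀ {a} → ExcludedMiddle a) (ext : ∀ {a b} → Extensionality a b)
  {ℓ : Level} (X : Set ℓ)
  where

  infix 4 _⊑_

  _⊑_ : Rel (X → Bool) ℓ
  S ⊑ R = ∀ {x} → T (S x) → T (R x)

  ⊑-antisym : ∀ {S R} → S ⊑ R → R ⊑ S → S ≡ R
  ⊑-antisym S⊑R R⊑S = ext λ x → ⇔→≡ {z = true} (mk⇔
    (Equivalence.to T-≡ ∘ S⊑R ∘ Equivalence.from T-≡)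
    (Equivalence.to T-≡ ∘ R⊑S ∘ Equivalence.from T-≡))

  next : (X → Bool) → Maybe X
  next S with em {P = ∃[ x ] ¬ T (S x)}
  ... | yes (x , _) = just x
  ... | no _        = nothing

  next-∉ : ∀ S {x} → next S ≡ just x → ¬ T (S x)
  next-∉ S eq with em {P = ∃[ x ] ¬ T (S x)}
  next-∉ S refl | yes (_ , x∉S) = x∉S
  next-∉ S ()   | no _

  next-exists : ∀ S {x} → ¬ T (S x) → ∃[ z ] next S ≡ just z
  next-exists S x∉S with em {P = ∃[ x ] ¬ T (S x)}
  ... | yes (z , _) = z , refl
  ... | no full     = ⊥-elim (full (_ , x∉S))

  grow : (X → Bool) → (X → Bool)
  grow S x = S x ∨ ⌊ em {P = next S ≡ just x} ⌋

  ⊑-grow : ∀ S → S ⊑ grow S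
  ⊑-grow S = Equivalence.from T-∨ ∘ inj₁

  next-∈ : ∀ S {x} → next S ≡ just x → T (grow S x)
  next-∈ S = Equivalence.from (T-∨ {S _}) ∘ inj₂ ∘ fromWitness

  grow⁻ : ∀ S {x} → T (grow S x) → T (S x) ⊎ next S ≡ just x
  grow⁻ S = [ inj₁ , inj₂ ∘ toWitness ]′ ∘ Equivalence.to (T-∨ {S _})

  -- `grow R` adds at most one point, the one chosen by `next R`, so a member of `S` outside `R`
  -- must be that point.
  squeeze : ∀ {S R} → R ⊑ S → S ⊑ grow R → S ⊑ R ⊎ grow R ⊑ S
  squeeze {S} {R} R⊑S S⊑R⁺ with em {P = ∃[ x ] T (S x) × ¬ T (R x)}
  ... | no S∖R≡∅ = inj₁ λ x∈S →
          decidable-stable em λ x∉R → S∖R≡∅ (_ , x∈S , x∉R)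
  ... | yes (x , x∈S , x∉R) with grow⁻ R (S⊑R⁺ x∈S)
  ...   | inj₁ x∈R = ⊥-elim (x∉R x∈R)
  ...   | inj₂ ≡x  = inj₂ ([ R⊑S
            , (λ ≡y → subst (T ∘ S) (just-injective (trans (sym ≡x) ≡y)) x∈S)
            ]′ ∘ grow⁻ R)

  Family : Set ℓ
  Family = (X → Bool) → Bool

  ⋃ : Family → (X → Bool)
  ⋃ P x = ⌊ em {P = ∃[ S ] T (P S) × T (S x)} ⌋

  ⊑-⋃ : ∀ {P S} → T (P S) → S ⊑ ⋃ P
  ⊑-⋃ S∈P x∈S = fromWitness (_ , S∈P , x∈S)

  -- The initial segments of the order under construction.

  data Tower : (X → Bool) → Set ℓ where
    growᵗ : ∀ {S} → Tower S → Tower (grow S)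
    ⋃ᵗ    : ∀ P → (∀ {S} → T (P S) → Tower S) → Tower (⋃ P)

  -- Zermelo's comparison argument: no set of the tower lies strictly between `S` and `grow S`.
  -- `compare` descends in the first tower and reduces to the case `S ⊑ R`, which `compare-⊑`
  -- settles by descending in the second.
  compare : ∀ {S R} → Tower S → Tower R → grow S ⊑ R ⊎ R ⊑ S
  compare-⊑ : ∀ {S R} → Tower S → Tower R → S ⊑ R → grow S ⊑ R ⊎ R ⊑ S

  compare (growᵗ {S} s) r with compare s r
  ... | inj₁ S⁺⊑R = compare-⊑ (growᵗ s) r S⁺⊑R
  ... | inj₂ R⊑S  = inj₂ (⊑-grow S ∘ R⊑S)
  compare {R = R} (⋃ᵗ P s) r with em {P = ∃[ S ] T (P S) × R ⊑ S}
  ... | yes (S , S∈P , R⊑S) = inj₂ (⊑-⋃ S∈P ∘ R⊑S)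
  ... | no ¬R⊑ = compare-⊑ (⋃ᵗ P s) r λ x∈⋃ →
          let S , S∈P , x∈S = toWitness x∈⋃ in
          case compare (s S∈P) r of λ where
            (inj₁ S⁺⊑R) → S⁺⊑R (⊑-grow S x∈S)
            (inj₂ R⊑S)  → ⊥-elim (¬R⊑ (S , S∈P , R⊑S))

  compare-⊑ {S} s (growᵗ {R} r) S⊑R⁺ with compare s r
  ... | inj₁ S⁺⊑R = inj₁ (⊑-grow R ∘ S⁺⊑R)
  ... | inj₂ R⊑S with squeeze R⊑S S⊑R⁺
  -- `next` is an arbitrary choice, so `grow S` and `grow R` are seen to agree only once `S` and `R`
  -- are equal as functions.
  ...   | inj₁ S⊑R  = inj₁ (subst (λ - → grow - ⊑ grow R) (⊑-antisym R⊑S S⊑R) id)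
  ...   | inj₂ R⁺⊑S = inj₂ R⁺⊑S
  compare-⊑ {S} s (⋃ᵗ P r) S⊑R with em {P = ∃[ R ] T (P R) × grow S ⊑ R}
  ... | yes (R , R∈P , S⁺⊑R) = inj₁ (⊑-⋃ R∈P ∘ S⁺⊑R)
  ... | no ¬S⁺⊑ = inj₂ λ x∈⋃ →
          let R , R∈P , x∈R = toWitness x∈⋃ in
          case compare s (r R∈P) of λ where
            (inj₁ S⁺⊑R) → ⊥-elim (¬S⁺⊑ (R , R∈P , S⁺⊑R))
            (inj₂ R⊑S)  → R⊑S x∈R

  avoiding : X → Family
  avoiding x S = ⌊ em {P = Tower S × ¬ T (S x)} ⌋

  -- The largest set of the tower that misses `x`; it serves as the set of strict predecessors of
  -- `x`.
  below : X → (X → Bool)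
  below x = ⋃ (avoiding x)

  below-tower : ∀ x → Tower (below x)
  below-tower x = ⋃ᵗ (avoiding x) (proj₁ ∘ toWitness)

  ∉-below : ∀ x → ¬ T (below x x)
  ∉-below x x∈ = let S , S∈ , x∈S = toWitness x∈ in proj₂ (toWitness S∈) x∈S

  below-max : ∀ {x S} → Tower S → ¬ T (S x) → S ⊑ below x
  below-max {x} s x∉S = ⊑-⋃ {avoiding x} (fromWitness (s , x∉S))

  -- If `x` were missing from `grow (below x)`, maximality would put this set inside `below x`,
  -- although it contains a point chosen outside. Hence `x` can be recovered from `below x`, which
  -- gives trichotomy.
  next-below : ∀ x → next (below x) ≡ just x
  next-below x with grow⁻ (below x) (decidable-stable em ¬¬x∈)
    where
    ¬¬x∈ : ¬ ¬ T (grow (below x) x)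
    ¬¬x∈ x∉ = let z , ≡z = next-exists (below x) (∉-below x) in
      next-∉ (below x) ≡z
        (below-max {x} (growᵗ (below-tower x)) x∉ (next-∈ (below x) ≡z))
  ... | inj₁ x∈ = ⊥-elim (∉-below x x∈)
  ... | inj₂ ≡x = ≡x

  _<_ : Rel X ℓ
  x < y = Lift ℓ (T (below y x))

  <-trans : Transitive _<_
  <-trans {x} {y} {z} (lift x<y) (lift y<z)
    with compare (below-tower y) (below-tower z)
  ... | inj₁ y⁺⊑z = lift (y⁺⊑z (⊑-grow (below y) x<y))
  ... | inj₂ z⊑y  = ⊥-elim (∉-below y (z⊑y y<z))

  <-cmp : Trichotomous _≡_ _<_
  <-cmp x y with compare (below-tower x) (below-tower y)
  ... | inj₁ x⁺⊑y = tri< x<y (λ { refl → ∉-below x (lower x<y) })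
                      (∉-below x ∘ lower ∘ <-trans x<y)
    where x<y = lift (x⁺⊑y (next-∈ (below x) (next-below x)))
  ... | inj₂ y⊑x with compare (below-tower y) (below-tower x)
  ...   | inj₁ y⁺⊑x = tri> (∉-below x ∘ lower ∘ λ x<y → <-trans x<y y<x)
                        (λ { refl → ∉-below x (lower y<x) }) y<x
    where y<x = lift (y⁺⊑x (next-∈ (below y) (next-below y)))
  -- Both inclusions hold, so the two segments coincide, and `next` of the common segment is both
  -- `x` and `y`.
  ...   | inj₂ x⊑y with just-injective (trans (sym (next-below x))
                     (trans (cong next (⊑-antisym x⊑y y⊑x)) (next-below y)))
  ...     | refl = tri≈ (∉-below x ∘ lower) refl (∉-below x ∘ lower)

  -- Induction along the tower: when `grow S` adds `x`, comparison gives `below x ⊑ S`, so every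
  -- predecessor of `x` already lies in `S`.
  tower-acc : ∀ {S x} → Tower S → T (S x) → Acc _<_ x
  tower-acc {x = x} (growᵗ {S} s) x∈S⁺ with grow⁻ S x∈S⁺
  ... | inj₁ x∈S = tower-acc s x∈S
  ... | inj₂ ≡x with compare s (below-tower x)
  ...   | inj₁ S⁺⊑x = ⊥-elim (∉-below x (S⁺⊑x x∈S⁺))
  ...   | inj₂ x⊑S  = acc λ y<x → tower-acc s (x⊑S (lower y<x))
  tower-acc (⋃ᵗ P s) x∈⋃ =
    let S , S∈P , x∈S = toWitness x∈⋃ in tower-acc (s S∈P) x∈S

  wellOrder : Ordinal ℓ
  wellOrder = record
    { Index = X
    ; _<_   = _<_
    ; isStrictTotalOrder = record
      { isStrictPartialOrder = record
        { isEquivalence = isEquivalence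
        ; irrefl        = λ { {x} refl (lift x<x) → ∉-below x x<x }
        ; trans         = <-trans
        ; <-resp-≈      = resp₂ _<_
        }
      ; compare = <-cmp
      }
    ; wellFounded = λ x →
        tower-acc (growᵗ (below-tower x)) (next-∈ (below x) (next-below x))
    }

-- Embeddings and chains of structures.

module _ {ℓ} {L : Language ℓ} where
  open Structure

  -- `j` is injective and reflects relations, so every clause can be checked after composing with
  -- `j`.
  factor : ∀ {M N P : Structure L} (i : M ↪ P) (j : N ↪ P) (h : ∣ M ∣ → ∣ N ∣) →
           (∀ x → to j (h x) ≡ to i x) → M ↪ N
  factor {M} {N} {P} i j h jh = record
    { to        = h
    ; injective = λ {x} {y} eq →
        i.injective (trans (sym (jh x)) (trans (cong (to j) eq) (jh y)))
    ; fun-homo  = λ F xs → j.injective (begin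
        to j (h (fun M F xs))           ≡⟨ jh _ ⟩
        to i (fun M F xs)               ≡⟨ i.fun-homo F xs ⟩
        fun P F (map (to i) xs)         ≡⟨ cong (fun P F) (map-jh xs) ⟨
        fun P F (map (to j) (map h xs)) ≡⟨ j.fun-homo F (map h xs) ⟨
        to j (fun N F (map h xs))       ∎)
    ; rel-homo  = λ R xs → mk⇔
        (Equivalence.from (j.rel-homo R _) ∘ subst (rel P R) (sym (map-jh xs))
          ∘ Equivalence.to (i.rel-homo R xs))
        (Equivalence.from (i.rel-homo R xs) ∘ subst (rel P R) (map-jh xs)
          ∘ Equivalence.to (j.rel-homo R _))
    }
    where
    open ≡-Reasoning
    module i = _↪_ i
    module j = _↪_ j
    map-jh : ∀ {n} (xs : Vec ∣ M ∣ n) → map (to j) (map h xs) ≡ map (to i) xs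
    map-jh xs = trans (sym (map-∘ (to j) h xs)) (map-cong jh xs)

  ≅-id : ∀ {M : Structure L} → M ≅ M
  ≅-id = record { embedding = ↪-id ; surjective = λ y → y , id }

  -- The target `A` is a bare type, because these facts also serve to define the structure on a
  -- union.
  module Cover (C : Chain {L = L}) {A : Set ℓ}
    (ι : ∀ i → ∣ Chain.stage C i ∣ → A)
    (ι-inc : ∀ {i j} (p : Chain._<_ C i j) x → ι j (to (Chain.inc C p) x) ≡ ι i x)
    (covers : ∀ y → ∃[ i ] ∃[ c ] ι i c ≡ y)
    where

    open Chain C
    private module O = IsStrictTotalOrder (Ordinal.isStrictTotalOrder length)

    -- Both bounds are strict because `inc` exists only along `<`; the limit length supplies them
    -- even when `i` and `j` coincide.
    upper : ∀ i j → ∃[ m ] i < m × j < m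
    upper i j with O.compare i j
    ... | tri< i<j _ _  = let m , j<m = proj₂ isLimit j in m , O.trans i<j j<m , j<m
    ... | tri≈ _ refl _ = let m , j<m = proj₂ isLimit j in m , j<m , j<m
    ... | tri> _ _ j<i  = let m , i<m = proj₂ isLimit i in m , i<m , O.trans j<i i<m

    -- Symbols have finite arity, so their arguments occur together in one stage. The empty tuple
    -- takes the stage that a limit ordinal provides.
    collect : ∀ {n} (ys : Vec A n) → ∃[ i ] ∃[ cs ] map (ι i) cs ≡ ys
    collect []       = proj₁ isLimit , [] , refl
    collect (y ∷ ys) =
      let i , c  , c≡  = covers y
          j , cs , cs≡ = collect ys
          m , i<m , j<m = upper i j
      in m , to (inc i<m) c ∷ map (to (inc j<m)) cs ,
         cong₂ _∷_ (trans (ι-inc i<m c) c≡)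
           (trans (sym (map-∘ (ι m) _ cs)) (trans (map-cong (ι-inc j<m) cs) cs≡))

  module Glue (C : Chain {L = L}) {U} (u : IsUnion C U)
    {P : Structure L} (e : ∀ i → Chain.stage C i ↪ P)
    (e-inc : ∀ {i j} (p : Chain._<_ C i j) x → to (e j) (to (Chain.inc C p) x) ≡ to (e i) x)
    where

    open Chain C
    open IsUnion u
    open Cover C (to ∘ ι) ι-inc covers
    open ≡-Reasoning

    map-to : ∣ U ∣ → ∣ P ∣
    map-to y = let i , c , _ = covers y in to (e i) c

    -- Independence of the stage picked by `covers`: two representatives of one element become equal
    -- in a later stage, since `ι m` is injective.
    map-ι : ∀ i c → map-to (to (ι i) c) ≡ to (e i) c
    map-ι i c with covers (to (ι i) c)
    ... | j , d , d≡c = let m , i<m , j<m = upper i j in begin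
      to (e j) d                ≡⟨ e-inc j<m d ⟨
      to (e m) (to (inc j<m) d) ≡⟨ cong (to (e m)) (_↪_.injective (ι m)
                                    (trans (ι-inc j<m d) (trans d≡c (sym (ι-inc i<m c))))) ⟩
      to (e m) (to (inc i<m) c) ≡⟨ e-inc i<m c ⟩
      to (e i) c                ∎

    maps-ι : ∀ i {n} (cs : Vec ∣ stage i ∣ n) →
             map map-to (map (to (ι i)) cs) ≡ map (to (e i)) cs
    maps-ι i cs = trans (sym (map-∘ map-to _ cs)) (map-cong (map-ι i) cs)

    glue : U ↪ P
    glue = record
      { to        = map-to
      ; injective = injective
      ; fun-homo  = fun-homo
      ; rel-homo  = rel-homo
      }
      where
      injective : ∀ {x y} → map-to x ≡ map-to y → x ≡ y
      injective {x} {y} eq with collect (x ∷ y ∷ [])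
      ... | i , c ∷ d ∷ [] , refl = cong (to (ι i)) (_↪_.injective (e i)
              (trans (sym (map-ι i c)) (trans eq (map-ι i d))))

      fun-homo : ∀ F xs → map-to (fun U F xs) ≡ fun P F (map map-to xs)
      fun-homo F xs with collect xs
      ... | i , cs , refl = begin
        map-to (fun U F (map (to (ι i)) cs))       ≡⟨ cong map-to (_↪_.fun-homo (ι i) F cs) ⟨
        map-to (to (ι i) (fun (stage i) F cs))     ≡⟨ map-ι i _ ⟩
        to (e i) (fun (stage i) F cs)              ≡⟨ _↪_.fun-homo (e i) F cs ⟩
        fun P F (map (to (e i)) cs)                ≡⟨ cong (fun P F) (maps-ι i cs) ⟨
        fun P F (map map-to (map (to (ι i)) cs))   ∎

      rel-homo : ∀ R xs → rel U R xs ⇔ rel P R (map map-to xs)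
      rel-homo R xs with collect xs
      ... | i , cs , refl = mk⇔
        (subst (rel P R) (sym (maps-ι i cs)) ∘ Equivalence.to (_↪_.rel-homo (e i) R cs)
          ∘ Equivalence.from (_↪_.rel-homo (ι i) R cs))
        (Equivalence.to (_↪_.rel-homo (ι i) R cs) ∘ Equivalence.from (_↪_.rel-homo (e i) R cs)
          ∘ subst (rel P R) (maps-ι i cs))

-- Proof-irrelevant subsets, finite supports and unions inside a structure.

module Classical
  (em : ∀ {a} → ExcludedMiddle a) (ext : ∀ {a b} → Extensionality a b)
  where

  -- Double negation makes membership irrelevant, by extensionality, and excluded middle recovers
  -- `P x` from it.
  squash : ∀ {a} {X : Set a} → Pred X a → Subset X
  squash P = record
    { member     = λ x → ¬ ¬ P x
    ; irrelevant = λ p q → ext λ ¬Px → ⊥-elim (p ¬Px)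
    }

  ∈-squash : ∀ {a} {P : Set a} → P → ¬ ¬ P
  ∈-squash x ¬x = ¬x x

  subOrdinal : ∀ {a} (o : Ordinal a) → Subset (Index o) → Ordinal a
  subOrdinal o D = record
    { Index = El D
    ; _<_   = λ x y → proj₁ x < proj₁ y
    ; isStrictTotalOrder = record
      { isStrictPartialOrder = record
        { isEquivalence = isEquivalence
        ; irrefl        = λ { refl → O.irrefl refl }
        ; trans         = O.trans
        ; <-resp-≈      = resp₂ _
        }
      ; compare = cmp
      }
    ; wellFounded = On.wellFounded proj₁ wellFounded
    }
    where
    open Ordinal o
    module O = IsStrictTotalOrder isStrictTotalOrder
    cmp : Trichotomous _≡_ (λ (x y : El D) → proj₁ x < proj₁ y)
    cmp x y with O.compare (proj₁ x) (proj₁ y)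
    ... | tri< x<y x≢y x≯y = tri< x<y (x≢y ∘ cong proj₁) x≯y
    ... | tri≈ x≮y x≡y x≯y = tri≈ x≮y (Injection.injective (El↣ D) x≡y) x≯y
    ... | tri> x≮y x≢y x>y = tri> x≮y (x≢y ∘ cong proj₁) x>y

  -- An element is determined by its position in `G`, which embeds the sum into a finite type.
  finite-support-<ℵ₀ : ∀ {a} {X Y : Set a} (G : List (X ⊎ Y)) →
    (El (squash λ y → inj₂ y ∈ˡ G) ⊎ El (squash λ x → inj₁ x ∈ˡ G)) <ᶜ ℵ₀
  finite-support-<ℵ₀ {X = X} {Y} G =
      mk↣ {to = toℕ ∘ pos} (pos-injective ∘ toℕ-injective)
    , λ f → ℕ→Fin-notInjective (pos ∘ Injection.to f) (Injection.injective f ∘ pos-injective)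
    where
    I = squash λ y → inj₂ y ∈ˡ G
    A = squash λ x → inj₁ x ∈ˡ G

    value : El I ⊎ El A → X ⊎ Y
    value (inj₁ (y , _)) = inj₂ y
    value (inj₂ (x , _)) = inj₁ x

    value-injective : ∀ {u v} → value u ≡ value v → u ≡ v
    value-injective {inj₁ _} {inj₁ _} eq =
      cong inj₁ (Injection.injective (El↣ I) (inj₂-injective eq))
    value-injective {inj₂ _} {inj₂ _} eq =
      cong inj₂ (Injection.injective (El↣ A) (inj₁-injective eq))
    value-injective {inj₁ _} {inj₂ _} ()
    value-injective {inj₂ _} {inj₁ _} ()

    value∈ : ∀ u → value u ∈ˡ G
    value∈ (inj₁ (_ , y∈)) = decidable-stable em y∈
    value∈ (inj₂ (_ , x∈)) = decidable-stable em x∈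

    pos : El I ⊎ El A → Fin (List.length G)
    pos = index ∘ value∈

    pos-injective : ∀ {u v} → pos u ≡ pos v → u ≡ v
    pos-injective {u} {v} eq =
      value-injective (index-injective (setoid _) (value∈ u) (value∈ v) eq)

  -- All stages embed compatibly in `N`, so the union of their images in `N` replaces an abstract
  -- direct limit.
  module Union {ℓ} {L : Language ℓ} (C : Chain {L = L})
    {N : Structure L} (j : ∀ i → Chain.stage C i ↪ N)
    (j-inc : ∀ {i i′} (p : Chain._<_ C i i′) x → to (j i′) (to (Chain.inc C p) x) ≡ to (j i) x)
    where

    open Chain C
    open Structure N

    image : Subset ∣ N ∣
    image = squash λ y → ∃[ i ] y ∈ range (to (j i))

    incl : El image → ∣ N ∣
    incl = proj₁

    incl-injective : ∀ {x y} → incl x ≡ incl y → x ≡ y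
    incl-injective = Injection.injective (El↣ image)

    ι₀ : ∀ i → ∣ stage i ∣ → El image
    ι₀ i c = to (j i) c , ∈-squash (i , c , refl)

    ι₀-inc : ∀ {i i′} (p : i < i′) x → ι₀ i′ (to (inc p) x) ≡ ι₀ i x
    ι₀-inc p x = incl-injective (j-inc p x)

    covers₀ : ∀ y → ∃[ i ] ∃[ c ] ι₀ i c ≡ y
    covers₀ (y , y∈) =
      let i , c , c≡ = decidable-stable em y∈ in i , c , incl-injective c≡

    open Cover C ι₀ ι₀-inc covers₀

    fun-closed : ∀ F (xs : Vec (El image) _) → member image (fun F (map incl xs))
    fun-closed F xs with collect xs
    ... | i , cs , refl = ∈-squash (i , Structure.fun (stage i) F cs ,
            trans (_↪_.fun-homo (j i) F cs) (cong (fun F) (map-∘ incl (ι₀ i) cs)))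

    ⋃C : Structure L
    ⋃C = record
      { Universe = El image
      ; fun      = λ F xs → fun F (map incl xs) , fun-closed F xs
      ; rel      = λ R xs → rel R (map incl xs)
      }

    ⋃C↪N : ⋃C ↪ N
    ⋃C↪N = record
      { to        = incl
      ; injective = incl-injective
      ; fun-homo  = λ F xs → refl
      ; rel-homo  = λ R xs → mk⇔ id id
      }

    ⋃C-isUnion : IsUnion C ⋃C
    ⋃C-isUnion = record
      { ι      = λ i → factor (j i) ⋃C↪N (ι₀ i) (λ _ → refl)
      ; ι-inc  = ι₀-inc
      ; covers = covers₀
      }

  -- Bundled `K`-embeddings, coherence and Tarski-Vaught.

  module _ {ℓ k} (𝐊 : AEC ℓ k) where
    open AEC 𝐊

    infix 4 _⟶_
    infixr 9 _∘⟶_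
    infixr 9 _·_

    record _⟶_ (M N : Structure L) : Set (ℓ ⊔ k) where
      field
        emb    : M ↪ N
        strong : M ≤ N via emb

      injective = _↪_.injective emb

    open _⟶_

    _·_ : ∀ {M N} → M ⟶ N → ∣ M ∣ → ∣ N ∣
    f · x = to (emb f) x

    ⟶-id : ∀ {M} → K M → M ⟶ M
    ⟶-id M∈K = record { emb = ↪-id ; strong = ≤-refl M∈K }

    _∘⟶_ : ∀ {M N P} → N ⟶ P → M ⟶ N → M ⟶ P
    g ∘⟶ f = record { emb = emb g ∘↪ emb f ; strong = ≤-trans (strong f) (strong g) }

    source∈K : ∀ {M N} → M ⟶ N → K M
    source∈K f = proj₁ (≤-in-K (strong f))

    target∈K : ∀ {M N} → M ⟶ N → K N
    target∈K f = proj₂ (≤-in-K (strong f))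

    -- An embedding also carries proofs; closure under isomorphism, applied to identities, shows
    -- that only its underlying map matters for `≤`.
    ≤-resp-≗ : ∀ {M N} {i i′ : M ↪ N} → (∀ x → to i x ≡ to i′ x) →
               M ≤ N via i → M ≤ N via i′
    ≤-resp-≗ = ≤-resp-≅ ≅-id ≅-id

    lift-⟶ : ∀ {M N P} (i : M ⟶ P) (j : N ⟶ P) → (∀ x → i · x ∈ range (j ·_)) →
             Σ[ h ∈ M ⟶ N ] ∀ x → j · h · x ≡ i · x
    lift-⟶ i j sub =
        record { emb = h ; strong = coherence h (proj₂ ∘ sub) (strong i) (strong j) }
      , proj₂ ∘ sub
      where h = factor (emb i) (emb j) (proj₁ ∘ sub) (proj₂ ∘ sub)

    module ChainUnion (C : Chain {L = L})
      (inc-strong : ∀ {i j} (p : Chain._<_ C i j) →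
                    Chain.stage C i ≤ Chain.stage C j via Chain.inc C p)
      {U : Structure L} (u : IsUnion C U)
      {P : Structure L} (e : ∀ i → Chain.stage C i ⟶ P)
      (e-inc : ∀ {i j} (p : Chain._<_ C i j) x → e j · to (Chain.inc C p) x ≡ e i · x)
      where

      open IsUnion u
      open Glue C u (emb ∘ e) e-inc

      ⋃⟶ : U ⟶ P
      ⋃⟶ = record
        { emb    = glue
        ; strong = proj₂ (proj₂ (tarski-vaught C u inc-strong)) glue
                     -- Tarski-Vaught asks about `glue ∘↪ ι i`, which agrees with the given strong
                     -- map `e i` pointwise.
                     λ i → ≤-resp-≗ (λ c → sym (map-ι i c)) (strong (e i))
        }

      ⋃⟶-ι : ∀ i c → ⋃⟶ · to (ι i) c ≡ e i · c
      ⋃⟶-ι = map-ι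

    -- Spans and equality of Galois types.

    record Span (N₁ N₂ : Structure L) {Y : Set ℓ}
                (a₁ : Y → ∣ N₁ ∣) (a₂ : Y → ∣ N₂ ∣) : Set (lsuc ℓ ⊔ k) where
      field
        {apex}  : Structure L
        left    : apex ⟶ N₁
        right   : apex ⟶ N₂
        seq     : Y → ∣ apex ∣
        left-≡  : ∀ y → left · seq y ≡ a₁ y
        right-≡ : ∀ y → right · seq y ≡ a₂ y

    reindex : ∀ {Y Y′ : Set ℓ} {N₁ N₂} {a₁ : Y → ∣ N₁ ∣} {a₂ : Y → ∣ N₂ ∣}
              {a₁′ : Y′ → ∣ N₁ ∣} {a₂′ : Y′ → ∣ N₂ ∣} (φ : Y′ → Y) →
              (∀ y → a₁ (φ y) ≡ a₁′ y) → (∀ y → a₂ (φ y) ≡ a₂′ y) →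
              Span N₁ N₂ a₁ a₂ → Span N₁ N₂ a₁′ a₂′
    reindex φ ≡a₁ ≡a₂ s = record
      { left    = left
      ; right   = right
      ; seq     = seq ∘ φ
      ; left-≡  = λ y → trans (left-≡ (φ y)) (≡a₁ y)
      ; right-≡ = λ y → trans (right-≡ (φ y)) (≡a₂ y)
      }
      where open Span s

    -- Joining parameters and sequence turns equality of types over `A` into the matching of one
    -- sequence, with the elements of `A` as ordinary entries.
    joint : ∀ {X A} (t : Triple 𝐊 X A) → A ⊎ X → ∣ Triple.N t ∣
    joint t = [ Injection.to (Triple.base t) , Triple.seq t ]′

    JointSpan : ∀ {X A} → Rel (Triple 𝐊 X A) (lsuc ℓ ⊔ k)
    JointSpan t₁ t₂ = Span (Triple.N t₁) (Triple.N t₂) (joint t₁) (joint t₂)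

    -- The apex carries a triple that is atomically equivalent to `t₁` inside the first model and to
    -- `t₂` inside the second.
    span⇒≡gtp : ∀ {X A} (t₁ t₂ : Triple 𝐊 X A) → JointSpan t₁ t₂ → _≡gtp_ 𝐊 t₁ t₂
    span⇒≡gtp t₁ t₂ s = _∷_ {y = mid}
      ( Triple.N t₁ , ↪-id , emb left , ≤-refl (Triple.N∈K t₁) , strong left
      , (λ a → sym (left-≡ (inj₁ a))) , (λ x → sym (left-≡ (inj₂ x))) )
      [ Triple.N t₂ , emb right , ↪-id , strong right , ≤-refl (Triple.N∈K t₂)
      , right-≡ ∘ inj₁ , right-≡ ∘ inj₂ ]
      where
      open Span s
      mid : Triple 𝐊 _ _
      mid = record
        { N    = apex
        ; N∈K  = source∈K left
        ; base = mk↣ {to = seq ∘ inj₁} λ {x} {y} eq → Injection.injective (Triple.base t₁)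
            (trans (sym (left-≡ (inj₁ x))) (trans (cong (left ·_) eq) (left-≡ (inj₁ y))))
        ; seq  = seq ∘ inj₂
        }

    -- Closures as pullbacks, and maps out of closures.

    module _ (intersections : AdmitsIntersections 𝐊) where

      module Hull {Y : Set ℓ} {N} (N∈K : K N) (a : Y → ∣ N ∣) where

        C : Closure 𝐊 N (range a)
        C = intersections N∈K (range a)

        hull : Structure L
        hull = Closure.M₀ C

        inc : hull ⟶ N
        inc = record { emb = Closure.inc C ; strong = Closure.M₀≤N C }

        gen : ∀ y → a y ∈ range (inc ·_)
        gen y = Equivalence.from (Closure.universe C (a y)) λ i _ sub → sub (y , refl)

        minimal : ∀ {P} (i : P ⟶ N) → (∀ y → a y ∈ range (i ·_)) →
                  ∀ c → inc · c ∈ range (i ·_)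
        minimal i gen∈ c = Equivalence.to (Closure.universe C _) (c , refl)
          (emb i) (strong i) λ { (y , refl) → gen∈ y }

      -- The closure of the common sequence inside `N` lies in the images of both `f₁` and `f₂`,
      -- hence maps back to `N₁` and `N₂`.
      cospan⇒span : ∀ {Y : Set ℓ} {N₁ N₂ N} {a₁ : Y → ∣ N₁ ∣} {a₂ : Y → ∣ N₂ ∣}
                    (f₁ : N₁ ⟶ N) (f₂ : N₂ ⟶ N) →
                    (∀ y → f₁ · a₁ y ≡ f₂ · a₂ y) → Span N₁ N₂ a₁ a₂
      cospan⇒span {a₁ = a₁} {a₂} f₁ f₂ eq = record
        { left    = proj₁ l
        ; right   = proj₁ r
        ; seq     = proj₁ ∘ gen
        ; left-≡  = λ y → injective f₁ (trans (proj₂ l _) (proj₂ (gen y)))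
        ; right-≡ = λ y → injective f₂ (trans (proj₂ r _) (trans (proj₂ (gen y)) (eq y)))
        }
        where
        open Hull (target∈K f₁) (λ y → f₁ · a₁ y)
        l = lift-⟶ inc f₁ (minimal f₁ λ y → a₁ y , refl)
        r = lift-⟶ inc f₂ (minimal f₂ λ y → a₂ y , sym (eq y))

      span-trans : ∀ {Y : Set ℓ} {N₁ N₂ N₃} {a₁ : Y → ∣ N₁ ∣} {a₂ : Y → ∣ N₂ ∣}
                   {a₃ : Y → ∣ N₃ ∣} → Span N₁ N₂ a₁ a₂ →
                   Span N₂ N₃ a₂ a₃ → Span N₁ N₃ a₁ a₃
      span-trans {a₂ = a₂} s t = record
        { left    = S.left ∘⟶ proj₁ l
        ; right   = T.right ∘⟶ proj₁ r
        ; seq     = proj₁ ∘ gen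
        ; left-≡  = λ y → trans (cong (S.left ·_) (injective S.right
            (trans (proj₂ l _) (trans (proj₂ (gen y)) (sym (S.right-≡ y)))))) (S.left-≡ y)
        ; right-≡ = λ y → trans (cong (T.right ·_) (injective T.left
            (trans (proj₂ r _) (trans (proj₂ (gen y)) (sym (T.left-≡ y)))))) (T.right-≡ y)
        }
        where
        module S = Span s
        module T = Span t
        open Hull (target∈K S.right) a₂
        l = lift-⟶ inc S.right (minimal S.right λ y → S.seq y , S.right-≡ y)
        r = lift-⟶ inc T.left (minimal T.left λ y → T.seq y , T.left-≡ y)

      E-at⇒span : ∀ {X A} (t₁ t₂ : Triple 𝐊 X A) → E-at 𝐊 t₁ t₂ → JointSpan t₁ t₂
      E-at⇒span _ _ (N , f₁ , f₂ , s₁ , s₂ , base≡ , seq≡) = cospan⇒span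
        (record { emb = f₁ ; strong = s₁ }) (record { emb = f₂ ; strong = s₂ })
        λ { (inj₁ a) → base≡ a ; (inj₂ x) → seq≡ x }

      ≡gtp⇒span : ∀ {X A} (t₁ t₂ : Triple 𝐊 X A) → _≡gtp_ 𝐊 t₁ t₂ → JointSpan t₁ t₂
      ≡gtp⇒span t₁ t₂ [ e ]              = E-at⇒span t₁ t₂ e
      ≡gtp⇒span t₁ t₃ (_∷_ {y = t₂} e p) =
        span-trans {a₂ = joint t₂} (E-at⇒span t₁ t₂ e) (≡gtp⇒span t₂ t₃ p)

      module _ {Y : Set ℓ} {N₁ N₂} {a₁ : Y → ∣ N₁ ∣} {a₂ : Y → ∣ N₂ ∣}
               (N₁∈K : K N₁) (N₂∈K : K N₂) where
        private
          module H₁ = Hull N₁∈K a₁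
          module H₂ = Hull N₂∈K a₂

        span⇒hull⟶ : Span N₁ N₂ a₁ a₂ →
          Σ[ e ∈ H₁.hull ⟶ N₂ ] ∀ y → e · proj₁ (H₁.gen y) ≡ a₂ y
        span⇒hull⟶ s = right ∘⟶ proj₁ l , λ y → trans (cong (right ·_)
            (injective left (trans (proj₂ l _)
              (trans (proj₂ (H₁.gen y)) (sym (left-≡ y)))))) (right-≡ y)
          where
          open Span s
          l = lift-⟶ H₁.inc left (H₁.minimal left λ y → seq y , left-≡ y)

        -- Pseudo-universality concerns isomorphisms of closures. The image of `e` contains `a₂`,
        -- hence the second hull; pulled back along `e`, that hull is a submodel containing the
        -- generators of the first, hence all of it.
        hull⟶⇒≅ : (e : H₁.hull ⟶ N₂) → (∀ y → e · proj₁ (H₁.gen y) ≡ a₂ y) →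
          Σ[ f ∈ H₁.hull ≅ H₂.hull ] ∀ c → H₂.inc · to (embedding f) c ≡ e · c
        hull⟶⇒≅ e e-gen =
            record { embedding = emb (proj₁ f) ; surjective = surj } , proj₂ f
          where
          back = lift-⟶ H₂.inc e (H₂.minimal e λ y → proj₁ (H₁.gen y) , e-gen y)
          onto : ∀ c → ∃[ d ] H₁.inc · (proj₁ back · d) ≡ H₁.inc · c
          onto = H₁.minimal (H₁.inc ∘⟶ proj₁ back) λ y →
            proj₁ (H₂.gen y) , trans (cong (H₁.inc ·_) (injective e
              (trans (proj₂ back _) (trans (proj₂ (H₂.gen y)) (sym (e-gen y))))))
              (proj₂ (H₁.gen y))
          f = lift-⟶ e H₂.inc λ c → let d , d≡ = onto c in
            d , trans (sym (proj₂ back d)) (cong (e ·_) (injective H₁.inc d≡))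
          surj : ∀ d → ∃[ c ] ∀ {z} → z ≡ c → proj₁ f · z ≡ d
          surj d = proj₁ back · d , λ { refl →
            injective H₂.inc (trans (proj₂ f _) (proj₂ back d)) }

        -- Both maps become isomorphisms onto the second hull that agree on generators, and `e`
        -- itself witnesses that `a₁` and `a₂` have the same type over the empty set.
        hull⟶-unique : PseudoUniversal 𝐊 → (e e′ : H₁.hull ⟶ N₂) →
          (∀ y → e · proj₁ (H₁.gen y) ≡ a₂ y) →
          (∀ y → e′ · proj₁ (H₁.gen y) ≡ a₂ y) →
          ∀ c → e · c ≡ e′ · c
        hull⟶-unique (_ , unique) e e′ e-gen e′-gen c =
          trans (sym (proj₂ f c)) (trans (cong (H₂.inc ·_) f≡f′) (proj₂ f′ c))
          where
          f = hull⟶⇒≅ e e-gen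
          f′ = hull⟶⇒≅ e′ e′-gen
          s : JointSpan (gtp∅ 𝐊 N₁ N₁∈K a₁) (gtp∅ 𝐊 N₂ N₂∈K a₂)
          s = record
            { left    = H₁.inc
            ; right   = e
            ; seq     = λ { (inj₂ y) → proj₁ (H₁.gen y) }
            ; left-≡  = λ { (inj₂ y) → proj₂ (H₁.gen y) }
            ; right-≡ = λ { (inj₂ y) → e-gen y }
            }
          sends : ∀ (d : H₁.hull ⟶ N₂) (d-gen : ∀ y → d · proj₁ (H₁.gen y) ≡ a₂ y) →
            Sends 𝐊 {a₁ = a₁} {a₂} (intersections N₁∈K (range a₁))
              (intersections N₂∈K (range a₂)) (proj₁ (hull⟶⇒≅ d d-gen))
          sends d d-gen y c c≡ = trans (proj₂ (hull⟶⇒≅ d d-gen) c)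
            (trans (cong (d ·_) (injective H₁.inc (trans c≡ (sym (proj₂ (H₁.gen y))))))
              (d-gen y))
          f≡f′ : to (embedding (proj₁ f)) c ≡ to (embedding (proj₁ f′)) c
          -- Sequences in the definition of pseudo-universality are indexed by ordinals, so `Y` is
          -- given a well-order.
          f≡f′ = unique N₁∈K N₂∈K (WellOrdering.wellOrder em ext Y) a₁ a₂
            (span⇒≡gtp (gtp∅ 𝐊 N₁ N₁∈K a₁) (gtp∅ 𝐊 N₂ N₂∈K a₂) s)
            (intersections N₁∈K _) (intersections N₂∈K _)
            (proj₁ f) (proj₁ f′) (sends e e-gen) (sends e′ e′-gen) c

    -- Spans on the union of a chain of index sets.

    module _ (pu : PseudoUniversal 𝐊) {N₁ N₂} (N₁∈K : K N₁) (N₂∈K : K N₂)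
             {X : Set ℓ} (a₁ : X → ∣ N₁ ∣) (a₂ : X → ∣ N₂ ∣) where
      private
        module H (B : Pred X ℓ) =
          Hull (proj₁ pu) N₁∈K (λ (x : Σ X B) → a₁ (proj₁ x))

      SpanOn : Pred X ℓ → Set (lsuc ℓ ⊔ k)
      SpanOn B = Span N₁ N₂ {Σ X B} (a₁ ∘ proj₁) (a₂ ∘ proj₁)

      spanOn-⊆ : ∀ {B B′ : Pred X ℓ} → B′ ⊆ B → SpanOn B → SpanOn B′
      spanOn-⊆ B′⊆B = reindex (λ (x , b) → x , B′⊆B b) (λ _ → refl) (λ _ → refl)

      module _ (δ : Ordinal ℓ) (lim : Ordinal.IsLimit δ) (B : Index δ → Pred X ℓ)
               (B-mono : ∀ {i j} → Ordinal._<_ δ i j → B i ⊆ B j)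
               (s : ∀ i → SpanOn (B i)) where

        open Ordinal δ using (_<_)

        private
          up : ∀ {i j} → i < j → Σ[ h ∈ H.hull (B i) ⟶ H.hull (B j) ]
                 ∀ c → H.inc (B j) · h · c ≡ H.inc (B i) · c
          up {i} {j} p = lift-⟶ (H.inc (B i)) (H.inc (B j))
            (H.minimal (B i) (H.inc (B j)) λ (x , b) → H.gen (B j) (x , B-mono p b))

          e : ∀ i → Σ[ e ∈ H.hull (B i) ⟶ N₂ ]
                ∀ y → e · proj₁ (H.gen (B i) y) ≡ a₂ (proj₁ y)
          e i = span⇒hull⟶ (proj₁ pu) N₁∈K N₂∈K (s i)

          -- The spans `s i` are given independently of each other. Both sides agree on the
          -- generators of the closure for `B i`, so uniqueness forces coherence.
          e-up : ∀ {i j} (p : i < j) c → proj₁ (e j) · proj₁ (up p) · c ≡ proj₁ (e i) · c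
          e-up {i} {j} p = hull⟶-unique (proj₁ pu) N₁∈K N₂∈K pu
            (proj₁ (e j) ∘⟶ proj₁ (up p)) (proj₁ (e i))
            (λ (x , b) → trans (cong (proj₁ (e j) ·_) (injective (H.inc (B j))
              (trans (proj₂ (up p) _) (trans (proj₂ (H.gen (B i) (x , b)))
                (sym (proj₂ (H.gen (B j) (x , B-mono p b))))))))
              (proj₂ (e j) (x , B-mono p b)))
            (proj₂ (e i))

          C : Chain {L = L}
          C = record
            { length    = δ
            ; isLimit   = lim
            ; stage     = λ i → H.hull (B i)
            ; inc       = λ p → emb (proj₁ (up p))
            ; inc-trans = λ {i} {j} {k} p q r x → injective (H.inc (B k))
                (trans (proj₂ (up q) _) (trans (proj₂ (up p) _) (sym (proj₂ (up r) _))))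
            }

          open Union C (λ i → emb (H.inc (B i))) (λ p → proj₂ (up p))
          module U {P} = ChainUnion C (λ p → strong (proj₁ (up p))) ⋃C-isUnion {P}

        spanOn-⋃ : SpanOn (λ x → ∃[ i ] B i x)
        spanOn-⋃ = record
          -- Gluing the inclusions, instead of taking `⋃C↪N`, lets Tarski-Vaught deliver strength
          -- here exactly as on the right.
          { left    = U.⋃⟶ (λ i → H.inc (B i)) (λ p → proj₂ (up p))
          ; right   = U.⋃⟶ (λ i → proj₁ (e i)) e-up
          ; seq     = λ (x , i , b) → ι₀ i (proj₁ (H.gen (B i) (x , b)))
          ; left-≡  = λ (x , i , b) →
              trans (U.⋃⟶-ι (λ i → H.inc (B i)) (λ p → proj₂ (up p)) i _)
                    (proj₂ (H.gen (B i) (x , b)))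
          ; right-≡ = λ (x , i , b) →
              trans (U.⋃⟶-ι (λ i → proj₁ (e i)) e-up i _) (proj₂ (e i) (x , b))
          }

      -- Transfinite induction from finite sets to the whole index set.

      module _ (finite : ∀ G → SpanOn (_∈ˡ G)) where
        open Ordinal (WellOrdering.wellOrder em ext X)
          using (_<_; isStrictTotalOrder; wellFounded)
        private module O = IsStrictTotalOrder isStrictTotalOrder

        _∪ˡ_ : Pred X ℓ → List X → Pred X ℓ
        (D ∪ˡ G) x = D x ⊎ x ∈ˡ G

        initial : Subset X → Ordinal ℓ
        initial = subOrdinal (WellOrdering.wellOrder em ext X)

        module _ (D : Subset X) where
          open Ordinal (initial D) using () renaming (_<_ to _<ᴰ_)

          -- Stated for a general `D` so as to serve twice: for the predecessors of a point during
          -- the induction, and for all of `X` at the end.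
          spanOn-step : (∀ {y} → member D y → ∀ G → SpanOn ((_< y) ∪ˡ G)) →
                        ∀ G → SpanOn (member D ∪ˡ G)
          spanOn-step below-span G
            with em {P = El D}
               | em {P = ∃[ i ] ∀ j → ¬ (i <ᴰ j)}
          ... | no empty | _ =
                spanOn-⊆ (λ { (inj₁ d) → ⊥-elim (empty (_ , d)) ; (inj₂ x∈G) → x∈G })
                         (finite G)
          ... | yes _ | yes ((m , m∈D) , max) =
                -- The hypothesis is applied to the longer list `m ∷ G`, which is why it ranges over
                -- all lists.
                spanOn-⊆ D∪G⊆ (below-span m∈D (m ∷ G))
            where
            D∪G⊆ : member D ∪ˡ G ⊆ (_< m) ∪ˡ (m ∷ G)
            D∪G⊆ (inj₂ x∈G) = inj₂ (there x∈G)
            D∪G⊆ {x} (inj₁ d) with O.compare x m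
            ... | tri< x<m _ _  = inj₁ x<m
            ... | tri≈ _ refl _ = inj₂ (here refl)
            ... | tri> _ _ m<x  = ⊥-elim (max (x , d) m<x)
          -- Without a greatest element `D` is itself a limit ordinal and indexes the chain; its
          -- stages are the strict segments below members of `D`, joined with `G`.
          ... | yes i₀ | no ¬max = spanOn-⊆ D∪G⊆ (spanOn-⋃ (initial D) (i₀ , above)
                (λ i → (_< proj₁ i) ∪ˡ G)
                (λ { p (inj₁ q) → inj₁ (O.trans q p) ; p (inj₂ x∈G) → inj₂ x∈G })
                (λ i → below-span (proj₂ i) G))
            where
            above : ∀ (i : El D) → ∃[ j ] i <ᴰ j
            above i = decidable-stable em λ ¬j → ¬max (i , λ j i<j → ¬j (j , i<j))
            D∪G⊆ : member D ∪ˡ G ⊆ λ x → ∃[ i ] ((_< proj₁ {B = member D} i) ∪ˡ G) x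
            D∪G⊆ (inj₁ d)   = let j , x<j = above (_ , d) in j , inj₁ x<j
            D∪G⊆ (inj₂ x∈G) = i₀ , inj₂ x∈G

        spanOn-< : ∀ y → Acc _<_ y → ∀ G → SpanOn ((_< y) ∪ˡ G)
        spanOn-< y (acc rs) G = spanOn-⊆
          (λ { (inj₁ p) → inj₁ (∈-squash p) ; (inj₂ q) → inj₂ q })
          -- A `Subset` is expected, so `_< y` is passed doubly negated and recovered by excluded
          -- middle.
          (spanOn-step (squash (_< y))
            (λ z<y → spanOn-< _ (rs (decidable-stable em z<y))) G)

        span-from-finite : Span N₁ N₂ a₁ a₂
        span-from-finite = reindex (λ x → x , inj₁ (lift tt)) (λ _ → refl) (λ _ → refl)
          (spanOn-step (record { member = λ _ → Lift ℓ ⊤ ; irrelevant = λ _ _ → refl })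
            (λ {y} _ → spanOn-< y (wellFounded y)) [])

    -- By contradiction: if no small `I` and `A` separate the types, every finite list `G` in the
    -- sum of `∣ M ∣` and `Index α` splits into such a pair, whose equal restrictions give a span on
    -- `G`; these spans yield one for the full types.
    tame-and-short : PseudoUniversal 𝐊 → FullyTameAndShort 𝐊 ℵ₀
    tame-and-short pu {M} M∈K α p q p≢q = decidable-stable em λ none →
      p≢q (span⇒≡gtp (gtp 𝐊 p) (gtp 𝐊 q)
        (span-from-finite pu (Triple.N∈K (gtp 𝐊 p)) (Triple.N∈K (gtp 𝐊 q)) _ _ λ G →
          let I = squash λ i → inj₂ i ∈ˡ G
              A = squash λ a → inj₁ a ∈ˡ G
          in reindex
            (λ { (inj₁ a , a∈) → inj₁ (a , ∈-squash a∈)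
               ; (inj₂ i , i∈) → inj₂ (i , ∈-squash i∈) })
            (λ { (inj₁ _ , _) → refl ; (inj₂ _ , _) → refl })
            (λ { (inj₁ _ , _) → refl ; (inj₂ _ , _) → refl })
            (≡gtp⇒span (proj₁ pu) (restrict 𝐊 p I A) (restrict 𝐊 q I A)
              (decidable-stable em λ ≢ → none (I , A , finite-support-<ℵ₀ G , ≢)))))

theorem3p7 : (∀ {a} → ExcludedMiddle a) →
    (∀ {a b} → Extensionality a b) →
    ∀ {ℓ k} (𝐊 : AEC ℓ k) →
    PseudoUniversal 𝐊 → FullyTameAndShort 𝐊 ℵ₀
theorem3p7 em ext = Classical.tame-and-short em ext
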